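{- The Min-Cut under the Deterministic Correlated Model (MCDCM) problem cannot be approximated to arbitrary degree in polynomial time, unless P=NP. That is, unless P=NP, for every approximation ratio $\alpha>1$ there is no polynomial-time algorithm which, given any network $G(\mathcal{N},\mathcal{L})$ whose link costs follow the deterministic correlated model, a source $s$ and a target $t$, returns a cut separating $s$ and $t$ of cost at most $\alpha\cdot opt$, where $opt$ is the minimum cost of a cut separating $s$ and $t$ and the cost of a cut is the joint total cost of its links.
   Context: A network $G(\mathcal{N},\mathcal{L})$ has a set $\mathcal{N}$ of $N$ nodes and a set $\mathcal{L}$ of $L$ directed links. A cut separating $s$ and $t$ is given by a partition of $\mathcal{N}$ into $X$ and $\mathcal{N}\setminus X$ with $s\in X$ and $t\in\mathcal{N}\setminus X$; its links are the links going from $X$ to $\mathcal{N}\setminus X$. Deterministic correlated model: each link $l$ has a nonnegative cost $w(l)$. For any $m>1$ distinct links $l_1,\dots,l_m$ the joint total cost is $$w(l_1)\oplus\cdots\oplus w(l_m)=\rho_{1,2,\dots,m}\cdot\big(w(l_1)+\cdots+w(l_m)\big),$$ where $\rho_{1,\dots,m}\in(0,\infty)$ is the correlation coefficient of this set of links ($\rho=1$: uncorrelated, $\rho>1$: increasing correlation, $\rho<1$: decreasing correlation). The joint total cost of a single link $l$ is $w(l)$. The cost of a cut is the joint total cost of the set of all its links. The costs and the correlations are part of the problem instance, given by a description from which the joint total cost of any given set of links can be computed in polynomial time. MCDCM problem: given such a network (with two or more link costs correlated), a source $s$ and a target $t$, find a cut separating $s$ and $t$ of minimum cost. -}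

module Defs where

open import Data.Bool using (Bool; true; false; not; _∧_)
open import Data.Fin using (Fin; toℕ)
open import Data.Fin.Subset using (Subset; inside; outside; ∣_∣; _∈_; _∉_)
open import Data.Integer as ℤ using ()
open import Data.List as List using (List; []; _∷_; length)
open import Data.Nat as ℕ using (ℕ; zero; suc)
open import Data.Nat.Binary as ℕᵇ using (ℕᵇ; 2[1+_]; 1+[2_])
open import Data.Product using (Σ-syntax; ∃-syntax; _×_; _,_)
open import Data.Rational as ℚ using (ℚ; 0ℚ; 1ℚ)
open import Data.Vec as Vec using (Vec; []; _∷_; lookup)
open import Data.Vec.Relation.Unary.Unique.Propositional using (Unique)
open import Function.Bundles using (_⇔_)
open import Relation.Binary.PropositionalEquality using (_≡_; _≢_)

------------------------------------------------------------------------
-- Model of computation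
--
-- While programs over binary trees with a single variable (the language I
-- of N. D. Jones, "Computability and Complexity from a Programming
-- Perspective").  Charging one unit per operation is polynomially
-- equivalent to Turing machine time: a run can be simulated with shared
-- subtrees as pointers, each operation then costing O(1) pointer steps,
-- and a test only inspects whether the root is nil.

data Tree : Set where
  nil  : Tree
  cons : Tree → Tree → Tree

size : Tree → ℕ
size nil        = 1
size (cons a b) = suc (size a ℕ.+ size b)

infixr 5 _⨾_

data Exp : Set where
  var   : Exp
  const : Tree → Exp
  pair  : Exp → Exp → Exp
  hd tl : Exp → Exp

data Cmd : Set where
  assign : Exp → Cmd
  _⨾_    : Cmd → Cmd → Cmd
  cond   : Exp → Cmd → Cmd → Cmd
  while  : Exp → Cmd → Cmd

head tail : Tree → Tree
head nil        = nil
head (cons a _) = a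
tail nil        = nil
tail (cons _ b) = b

eval : Exp → Tree → Tree
eval var        σ = σ
eval (const d)  σ = d
eval (pair e f) σ = cons (eval e σ) (eval f σ)
eval (hd e)     σ = head (eval e σ)
eval (tl e)     σ = tail (eval e σ)

cost : Exp → ℕ
cost var        = 1
cost (const _)  = 1
cost (pair e f) = suc (cost e ℕ.+ cost f)
cost (hd e)     = suc (cost e)
cost (tl e)     = suc (cost e)

-- c ⊢ σ ⇓ τ [ t ]: started on the tree σ, the program c halts with the
-- tree τ after t units of time.  A test succeeds on every tree but nil.

infix 4 _⊢_⇓_[_]

data _⊢_⇓_[_] : Cmd → Tree → Tree → ℕ → Set where
  ⇓assign : ∀ {e σ} → assign e ⊢ σ ⇓ eval e σ [ suc (cost e) ]
  ⇓seq    : ∀ {c d σ τ υ m n} →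
            c ⊢ σ ⇓ τ [ m ] → d ⊢ τ ⇓ υ [ n ] → c ⨾ d ⊢ σ ⇓ υ [ m ℕ.+ n ]
  ⇓then   : ∀ {e c d σ τ n} → eval e σ ≢ nil →
            c ⊢ σ ⇓ τ [ n ] → cond e c d ⊢ σ ⇓ τ [ suc (cost e) ℕ.+ n ]
  ⇓else   : ∀ {e c d σ τ n} → eval e σ ≡ nil →
            d ⊢ σ ⇓ τ [ n ] → cond e c d ⊢ σ ⇓ τ [ suc (cost e) ℕ.+ n ]
  ⇓stop   : ∀ {e c σ} → eval e σ ≡ nil →
            while e c ⊢ σ ⇓ σ [ suc (cost e) ]
  ⇓loop   : ∀ {e c σ τ υ m n} → eval e σ ≢ nil →
            c ⊢ σ ⇓ τ [ m ] → while e c ⊢ τ ⇓ υ [ n ] →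
            while e c ⊢ σ ⇓ υ [ suc (cost e) ℕ.+ (m ℕ.+ n) ]

------------------------------------------------------------------------
-- Encodings as trees

encodeList : {A : Set} → (A → Tree) → List A → Tree
encodeList f []       = nil
encodeList f (x ∷ xs) = cons (f x) (encodeList f xs)

encodeBool : Bool → Tree
encodeBool false = nil
encodeBool true  = cons nil nil

encodeBits : List Bool → Tree
encodeBits = encodeList encodeBool

encodeUnary : ℕ → Tree
encodeUnary zero    = nil
encodeUnary (suc n) = cons nil (encodeUnary n)

encodeBinary : ℕᵇ → Tree
encodeBinary ℕᵇ.zero  = nil
encodeBinary 2[1+ b ] = cons nil (encodeBinary b)
encodeBinary 1+[2 b ] = cons (cons nil nil) (encodeBinary b)

-- The sign is dropped: only nonnegative rationals are ever encoded.
encodeℚ : ℚ → Tree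
encodeℚ q = cons (encodeBinary (ℕᵇ.fromℕ ℤ.∣ ℚ.numerator q ∣))
                 (encodeBinary (ℕᵇ.fromℕ (ℚ.denominatorℕ q)))

encodeSubset : ∀ {n} → Subset n → Tree
encodeSubset S = encodeBits (Vec.toList S)

encodeExp : Exp → Tree
encodeExp var        = cons (encodeUnary 0) nil
encodeExp (const d)  = cons (encodeUnary 1) d
encodeExp (pair e f) = cons (encodeUnary 2) (cons (encodeExp e) (encodeExp f))
encodeExp (hd e)     = cons (encodeUnary 3) (encodeExp e)
encodeExp (tl e)     = cons (encodeUnary 4) (encodeExp e)

encodeCmd : Cmd → Tree
encodeCmd (assign e)   = cons (encodeUnary 0) (encodeExp e)
encodeCmd (c ⨾ d)      = cons (encodeUnary 1) (cons (encodeCmd c) (encodeCmd d))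
encodeCmd (cond e c d) = cons (encodeUnary 2)
                           (cons (encodeExp e) (cons (encodeCmd c) (encodeCmd d)))
encodeCmd (while e c)  = cons (encodeUnary 3) (cons (encodeExp e) (encodeCmd c))

------------------------------------------------------------------------
-- Polynomial time, P and NP

-- Every polynomial is bounded by one of this form.
bound : (c k n : ℕ) → ℕ
bound c k n = c ℕ.* n ℕ.^ k ℕ.+ c

SolvesInPolyTime : {A : Set} (p : Cmd) (encode : A → Tree)
                   (Correct : A → Tree → Set) → Set
SolvesInPolyTime p encode Correct =
  ∃[ c ] ∃[ k ] (∀ a → ∃[ out ] ∃[ t ]
    (p ⊢ encode a ⇓ out [ t ]) × t ℕ.≤ bound c k (size (encode a)) × Correct a out)

DecidableInPolyTime : {A : Set} (encode : A → Tree) (Q : A → Set) → Set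
DecidableInPolyTime encode Q =
  ∃[ p ] SolvesInPolyTime p encode (λ a out → out ≢ nil ⇔ Q a)

Language : Set₁
Language = List Bool → Set

InP : Language → Set
InP = DecidableInPolyTime encodeBits

encodeBitsPair : List Bool × List Bool → Tree
encodeBitsPair (x , y) = cons (encodeBits x) (encodeBits y)

InNP : Language → Set₁
InNP L = Σ[ R ∈ (List Bool × List Bool → Set) ]
  DecidableInPolyTime encodeBitsPair R ×
  (∃[ c ] ∃[ k ] (∀ x →
    L x ⇔ (∃[ y ] length y ℕ.≤ bound c k (length x) × R (x , y))))

P≡NP : Set₁
P≡NP = ∀ L → InP L ⇔ InNP L

------------------------------------------------------------------------
-- Networks and cuts under the deterministic correlated model

-- The value ρ S is unconstrained, and never used, if S has at most one link.
record Network : Set where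
  field
    N L      : ℕ
    links    : Vec (Fin N × Fin N) L
    distinct : Unique links
    w        : Vec ℚ L
    w≥0      : ∀ l → 0ℚ ℚ.≤ lookup w l
    ρ        : Subset L → ℚ
    ρ>0      : ∀ S → 1 ℕ.< ∣ S ∣ → 0ℚ ℚ.< ρ S

  Correlated : Set
  Correlated = ∃[ S ] 1 ℕ.< ∣ S ∣ × ρ S ≢ 1ℚ

total : ∀ {n} → Subset n → Vec ℚ n → ℚ
total []            []      = 0ℚ
total (inside  ∷ S) (q ∷ v) = q ℚ.+ total S v
total (outside ∷ S) (q ∷ v) = total S v

module _ (G : Network) where
  open Network G

  jointCost : Subset L → ℚ
  jointCost S with ∣ S ∣
  ... | suc (suc _) = ρ S ℚ.* total S w
  ... | _           = total S w

  record Cut (s t : Fin N) : Set where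
    field
      X   : Subset N
      s∈X : s ∈ X
      t∉X : t ∉ X

    cutLinks : Subset L
    cutLinks = Vec.map (λ (u , v) → lookup X u ∧ not (lookup X v)) links

    cutCost : ℚ
    cutCost = jointCost cutLinks

  IsMinCutCost : (s t : Fin N) → ℚ → Set
  IsMinCutCost s t opt =
    (Σ[ C ∈ Cut s t ] Cut.cutCost C ≡ opt) × (∀ (C : Cut s t) → opt ℚ.≤ Cut.cutCost C)

------------------------------------------------------------------------
-- The MCDCM problem

-- The correlations are described by a program together with a time bound.
-- As the time bound is written in unary, ρ can be computed from the
-- description in polynomial time, by running the program.  Conversely, if
-- ρ is given by any other data d from which it can be computed in
-- polynomial time, then it is described by a program with d as a constant.
record Instance : Set where
  field
    G : Network
  open Network G public
  field
    correlated : Correlated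
    s t        : Fin N
    s≢t        : s ≢ t
    ρ-program  : Cmd
    ρ-time     : ℕ
    ρ-computed : ∀ S → 1 ℕ.< ∣ S ∣ → ∃[ n ]
                 (ρ-program ⊢ encodeSubset S ⇓ encodeℚ (ρ S) [ n ]) × n ℕ.≤ ρ-time

encodeNode : ∀ {n} → Fin n → Tree
encodeNode i = encodeUnary (toℕ i)

encodeLink : ∀ {n} → Fin n × Fin n → Tree
encodeLink (u , v) = cons (encodeNode u) (encodeNode v)

encodeInstance : Instance → Tree
encodeInstance I =
  cons (encodeUnary N)
  (cons (encodeList encodeLink (Vec.toList links))
  (cons (encodeList encodeℚ (Vec.toList w))
  (cons (encodeNode s)
  (cons (encodeNode t)
  (cons (encodeCmd ρ-program)
        (encodeUnary ρ-time))))))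
  where open Instance I

IsApproximateSolution : ℚ → Instance → Tree → Set
IsApproximateSolution α I out =
  Σ[ C ∈ Cut G s t ] out ≡ encodeSubset (Cut.X C) ×
  (∃[ opt ] IsMinCutCost G s t opt × Cut.cutCost C ℚ.≤ α ℚ.* opt)
  where open Instance I

ApproximatesMCDCM : ℚ → Cmd → Set
ApproximatesMCDCM α p =
  SolvesInPolyTime p encodeInstance (IsApproximateSolution α)

{-# OPTIONS --safe #-}
module Submission where

-- Since the correlations are given by a program, the verifier of a language
-- in NP can be run inside them.  For an input x take a star: the target is
-- the centre, every other node has one link to it, and the source is one of
-- those nodes.  The link of the source costs 1 and all others cost 0, so a
-- cut with link set S costs ρ S (or 1, if S has a single link), and every
-- set S containing the link of the source is the link set of a cut.  Read S
-- as a witness y and let ρ S be ε with α ε = ½ if the verifier accepts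
-- (x , y), and 2 otherwise.  If x has a witness, then the minimum cost is at
-- most ε, so a cut within the ratio α costs at most ½, which forces its
-- witness to be accepted.  Hence x is decided by building the instance,
-- approximating, and running the verifier on the witness that is read off.

open import Defs
open import Data.Bool using (Bool; true; false; not; _∧_)
open import Data.Bool.Properties using (∧-identityʳ)
open import Data.Fin using (Fin; zero; suc; toℕ)
open import Data.Fin.Properties using (toℕ<n)
open import Data.Fin.Subset as Subset using (Subset; inside; outside; ∣_∣)
open import Data.List as List using (List; []; _∷_; length)
open import Data.List.Properties using (length-drop)
open import Data.Nat as ℕ using (ℕ; zero; suc; _+_; _*_; _^_; _∸_; _≤_; z≤n; s≤s)
open import Data.Nat.Properties
open import Data.Nat.Tactic.RingSolver using (solve-∀)
open import Data.Product using (Σ-syntax; ∃-syntax; _×_; _,_; proj₁; proj₂)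
open import Data.Rational as ℚ using (ℚ; 0ℚ; 1ℚ; ½; _<_)
import Data.Rational.Properties as ℚ
open import Data.Vec as Vec using (Vec; []; _∷_; here; there; lookup)
open import Data.Vec.Properties
  using (tabulate-∘; tabulate∘lookup; tabulate-cong; toList∘fromList; length-toList; lookup-replicate)
open import Data.Vec.Relation.Unary.Unique.Propositional.Properties using (tabulate⁺)
open import Function using (_∘_; id)
open import Function.Bundles using (_⇔_; mk⇔; Equivalence)
open import Relation.Binary.PropositionalEquality
open import Relation.Nullary using (¬_; Dec; yes; no; contradiction)
open import Relation.Nullary.Decidable using (from-yes; from-no)

-- Polynomial growth

-- The base 2 + ℓ a is at least 2, so that a sum of two powers, and any
-- constant, is again below a power.
infix 4 _≼_
record _≼_ {A : Set} (f ℓ : A → ℕ) : Set where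
  constructor poly
  field
    degree  : ℕ
    bounded : ∀ a → f a ≤ (2 + ℓ a) ^ degree

-- For positive `n`, `2 + n ≤ 3 * n`, which yields the factor `3 ^ k`. At 0 the summand `3 ^ k` of
-- `bound` takes over.
power≤bound : ∀ k n → (2 + n) ^ k ≤ bound (3 ^ k) k n
power≤bound k zero    = ≤-trans (^-monoˡ-≤ k (n≤1+n 2)) (m≤n+m (3 ^ k) (3 ^ k * 0 ^ k))
power≤bound k (suc n) = begin
  (3 + n) ^ k                   ≤⟨ ^-monoˡ-≤ k 3+n≤3*[1+n] ⟩
  (3 * suc n) ^ k               ≡⟨ ^-distrib 3 (suc n) k ⟩
  3 ^ k * suc n ^ k             ≤⟨ m≤m+n _ (3 ^ k) ⟩
  bound (3 ^ k) k (suc n)       ∎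
  where
  open ≤-Reasoning
  3+n≤3*[1+n] : 3 + n ≤ 3 * suc n
  3+n≤3*[1+n] = ≤-trans (+-monoʳ-≤ 3 (m≤m+n n (n + n))) (≤-reflexive (lemma n))
    where
    lemma : ∀ n → 3 + (n + (n + n)) ≡ 3 * (1 + n)
    lemma = solve-∀
  ^-distrib : ∀ a b k → (a * b) ^ k ≡ a ^ k * b ^ k
  ^-distrib a b zero    = refl
  ^-distrib a b (suc k) = trans (cong (a * b *_) (^-distrib a b k)) (lemma a b (a ^ k) (b ^ k))
    where
    lemma : ∀ a b c d → a * b * (c * d) ≡ a * c * (b * d)
    lemma = solve-∀

-- Abstract, as unfolding the degrees is infeasible.
abstract

  module _ {A : Set} {ℓ : A → ℕ} where

    ≼-refl : ℓ ≼ ℓ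
    ≼-refl = poly 1 λ a → ≤-trans (m≤n+m (ℓ a) 2) (≤-reflexive (sym (*-identityʳ (2 + ℓ a))))

    ≼-mono : ∀ {f g : A → ℕ} → (∀ a → f a ≤ g a) → g ≼ ℓ → f ≼ ℓ
    ≼-mono f≤g (poly k p) = poly k λ a → ≤-trans (f≤g a) (p a)

    ≼-+ : ∀ {f g : A → ℕ} → f ≼ ℓ → g ≼ ℓ → (λ a → f a + g a) ≼ ℓ
    ≼-+ {f} {g} (poly i p) (poly j q) = poly (suc (i + j)) λ a →
      let B = 2 + ℓ a
          open ≤-Reasoning in begin
      f a + g a                        ≤⟨ +-mono-≤ (p a) (q a) ⟩
      B ^ i + B ^ j                    ≤⟨ +-mono-≤ (^-monoʳ-≤ B (m≤m+n i j)) (^-monoʳ-≤ B (m≤n+m j i)) ⟩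
      B ^ (i + j) + B ^ (i + j)        ≡⟨ cong (B ^ (i + j) +_) (sym (+-identityʳ _)) ⟩
      2 * B ^ (i + j)                  ≤⟨ *-monoˡ-≤ (B ^ (i + j)) (m≤m+n 2 (ℓ a)) ⟩
      B * B ^ (i + j)                  ∎

    ≼-* : ∀ {f g : A → ℕ} → f ≼ ℓ → g ≼ ℓ → (λ a → f a * g a) ≼ ℓ
    ≼-* (poly i p) (poly j q) = poly (i + j) λ a →
      ≤-trans (*-mono-≤ (p a) (q a)) (≤-reflexive (sym (^-distribˡ-+-* (2 + ℓ a) i j)))

    ≼-^ : ∀ {f : A → ℕ} k → f ≼ ℓ → (λ a → f a ^ k) ≼ ℓ
    ≼-^ k (poly i p) = poly (i * k) λ a →
      ≤-trans (^-monoˡ-≤ k (p a)) (≤-reflexive (^-*-assoc (2 + ℓ a) i k))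

    ≼-const : ∀ c → (λ _ → c) ≼ ℓ
    ≼-const zero    = poly 0 λ _ → z≤n
    ≼-const (suc c) = ≼-+ {f = λ _ → 1} (poly 0 λ _ → ≤-refl) (≼-const c)

    ≼-bound : ∀ {f : A → ℕ} c k → f ≼ ℓ → (λ a → bound c k (f a)) ≼ ℓ
    ≼-bound c k p = ≼-+ (≼-* (≼-const c) (≼-^ k p)) (≼-const c)

  ≼-trans : ∀ {A : Set} {f g ℓ : A → ℕ} → f ≼ g → g ≼ ℓ → f ≼ ℓ
  ≼-trans (poly k p) q = ≼-mono p (≼-^ k (≼-+ (≼-const 2) q))

  ≼-∘ : ∀ {A B : Set} {f ℓ : A → ℕ} (h : B → A) → f ≼ ℓ → f ∘ h ≼ ℓ ∘ h
  ≼-∘ h (poly k p) = poly k (p ∘ h)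

  ≼⇒bound : ∀ {A : Set} {f ℓ : A → ℕ} → f ≼ ℓ → ∃[ c ] ∃[ k ] (∀ a → f a ≤ bound c k (ℓ a))
  ≼⇒bound {ℓ = ℓ} (poly k p) = 3 ^ k , k , λ a → ≤-trans (p a) (power≤bound k (ℓ a))

-- Programs running in polynomial time

infix 4 _⊢_⇓_within_
_⊢_⇓_within_ : Cmd → Tree → Tree → ℕ → Set
p ⊢ σ ⇓ τ within t = ∃[ n ] (p ⊢ σ ⇓ τ [ n ]) × n ≤ t

weaken : ∀ {p σ τ t u} → t ≤ u → p ⊢ σ ⇓ τ within t → p ⊢ σ ⇓ τ within u
weaken t≤u (n , run , n≤t) = n , run , ≤-trans n≤t t≤u

within-⨾ : ∀ {p q σ τ υ m n} → p ⊢ σ ⇓ τ within m → q ⊢ τ ⇓ υ within n → p ⨾ q ⊢ σ ⇓ υ within (m + n)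
within-⨾ (_ , r , i≤m) (_ , s , j≤n) = _ , ⇓seq r s , +-mono-≤ i≤m j≤n

within-assign : ∀ {e σ τ} → eval e σ ≡ τ → assign e ⊢ σ ⇓ τ within suc (cost e)
within-assign refl = _ , ⇓assign , ≤-refl

-- Inputs and outputs are families over `A`, and time is measured by `ℓ` on the index. All phases of
-- a long program can thus be charged to the one original input.
record PolyTime {A : Set} (ℓ : A → ℕ) (p : Cmd) (σ τ : A → Tree) : Set where
  constructor polyTime
  field
    {time}    : A → ℕ
    feasible  : time ≼ ℓ
    run       : ∀ a → p ⊢ σ a ⇓ τ a within time a

module _ {A : Set} {ℓ : A → ℕ} where

  assign-poly : ∀ e {σ τ : A → Tree} → (∀ a → eval e (σ a) ≡ τ a) → PolyTime ℓ (assign e) σ τ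
  assign-poly e eq = polyTime (≼-const (suc (cost e))) λ a → within-assign (eq a)

  infixr 5 _⨾-poly_
  _⨾-poly_ : ∀ {p q} {σ τ υ : A → Tree} →
             PolyTime ℓ p σ τ → PolyTime ℓ q τ υ → PolyTime ℓ (p ⨾ q) σ υ
  polyTime f r ⨾-poly polyTime g s = polyTime (≼-+ f g) λ a → within-⨾ (r a) (s a)

reindex : ∀ {A B : Set} {ℓ : A → ℕ} {ℓ′ : B → ℕ} {p σ τ} (h : B → A) → ℓ ∘ h ≼ ℓ′ →
          PolyTime ℓ p σ τ → PolyTime ℓ′ p (σ ∘ h) (τ ∘ h)
reindex h q (polyTime f r) = polyTime (≼-trans (≼-∘ h f) q) (r ∘ h)

module _ {A : Set} {p : Cmd} {encode : A → Tree} where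

  solver-poly : {Correct : A → Tree → Set} → SolvesInPolyTime p encode Correct →
                Σ[ out ∈ (A → Tree) ] PolyTime (size ∘ encode) p encode out × (∀ a → Correct a (out a))
  solver-poly (c , k , solve) =
    (λ a → let out , _ = solve a in out) ,
    polyTime (≼-bound c k ≼-refl) (λ a → let _ , t , r , t≤ , _ = solve a in t , r , t≤) ,
    (λ a → let _ , _ , _ , _ , correct = solve a in correct)

  poly-solver : {Correct : A → Tree → Set} {ℓ : A → ℕ} {out : A → Tree} →
                (∀ a → ℓ a ≤ size (encode a)) →
                PolyTime ℓ p encode out → (∀ a → Correct a (out a)) → SolvesInPolyTime p encode Correct
  poly-solver {ℓ = ℓ} ℓ≤size (polyTime f r) correct =
    let c , k , time≤ = ≼⇒bound f in
    c , k , λ a → let t , run , t≤ = r a in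
      _ , t , run , ≤-trans t≤ (≤-trans (time≤ a) (bound-mono c k (ℓ≤size a))) , correct a
    where
    bound-mono : ∀ c k {m n} → m ≤ n → bound c k m ≤ bound c k n
    bound-mono c k m≤n = +-monoˡ-≤ c (*-monoʳ-≤ c (^-monoˡ-≤ k m≤n))

-- Running a program on the head of the store

frameExp : Exp → Exp
frameExp var        = hd var
frameExp (const d)  = const d
frameExp (pair e f) = pair (frameExp e) (frameExp f)
frameExp (hd e)     = hd (frameExp e)
frameExp (tl e)     = tl (frameExp e)

frame : Cmd → Cmd
frame (assign e)   = assign (pair (frameExp e) (tl var))
frame (c ⨾ d)      = frame c ⨾ frame d
frame (cond e c d) = cond (frameExp e) (frame c) (frame d)
frame (while e c)  = while (frameExp e) (frame c)

eval-frameExp : ∀ e σ ρ → eval (frameExp e) (cons σ ρ) ≡ eval e σ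
eval-frameExp var        σ ρ = refl
eval-frameExp (const d)  σ ρ = refl
eval-frameExp (pair e f) σ ρ = cong₂ cons (eval-frameExp e σ ρ) (eval-frameExp f σ ρ)
eval-frameExp (hd e)     σ ρ = cong head (eval-frameExp e σ ρ)
eval-frameExp (tl e)     σ ρ = cong tail (eval-frameExp e σ ρ)

-- Only `var` becomes dearer, from cost 1 to cost 2 as `hd var`.
cost-frameExp : ∀ e → cost (frameExp e) ≤ 2 * cost e
cost-frameExp var        = ≤-refl
cost-frameExp (const d)  = s≤s z≤n
cost-frameExp (pair e f) = begin
  1 + (cost (frameExp e) + cost (frameExp f)) ≤⟨ s≤s (+-mono-≤ (cost-frameExp e) (cost-frameExp f)) ⟩
  1 + (2 * cost e + 2 * cost f)               ≤⟨ n≤1+n _ ⟩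
  2 + (2 * cost e + 2 * cost f)               ≡⟨ lemma (cost e) (cost f) ⟩
  2 * (1 + (cost e + cost f))                 ∎
  where
  open ≤-Reasoning
  lemma : ∀ a b → 2 + (2 * a + 2 * b) ≡ 2 * (1 + (a + b))
  lemma = solve-∀
cost-frameExp (hd e) =
  ≤-trans (s≤s (cost-frameExp e)) (≤-trans (n≤1+n _) (≤-reflexive (sym (*-suc 2 (cost e)))))
cost-frameExp (tl e) =
  ≤-trans (s≤s (cost-frameExp e)) (≤-trans (n≤1+n _) (≤-reflexive (sym (*-suc 2 (cost e)))))

-- The surplus 3 pays for rebuilding the pair after an assignment.
frame-test : ∀ e → 3 + suc (cost (frameExp e)) ≤ 4 * suc (cost e)
frame-test e = begin
  4 + cost (frameExp e)  ≤⟨ +-monoʳ-≤ 4 (cost-frameExp e) ⟩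
  4 + 2 * cost e         ≤⟨ +-monoʳ-≤ 4 (*-monoˡ-≤ (cost e) (m≤m+n 2 2)) ⟩
  4 + 4 * cost e         ≡⟨ sym (*-suc 4 (cost e)) ⟩
  4 * suc (cost e)       ∎
  where open ≤-Reasoning

frame-run : ∀ {c σ τ n} ρ → c ⊢ σ ⇓ τ [ n ] → frame c ⊢ cons σ ρ ⇓ cons τ ρ within (4 * n)
frame-run {assign e} {σ} ρ ⇓assign =
  weaken (≤-trans (≤-reflexive (lemma (cost (frameExp e)))) (frame-test e))
         (within-assign (cong (λ τ → cons τ ρ) (eval-frameExp e σ ρ)))
  where
  lemma : ∀ n → suc (suc (n + 2)) ≡ 4 + n
  lemma = solve-∀
frame-run ρ (⇓seq {m = m} {n} r s) =
  weaken (≤-reflexive (sym (*-distribˡ-+ 4 m n))) (within-⨾ (frame-run ρ r) (frame-run ρ s))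
frame-run {σ = σ} ρ (⇓then {e} {n = n} e≢nil r) =
  let _ , r′ , le = frame-run ρ r in
  _ , ⇓then (e≢nil ∘ trans (sym (eval-frameExp e σ ρ))) r′ ,
  -- A test does not rebuild the pair, so the surplus 3 is thrown away.
  ≤-trans (+-mono-≤ (m+n≤o⇒n≤o 3 (frame-test e)) le) (≤-reflexive (sym (*-distribˡ-+ 4 (suc (cost e)) n)))
frame-run {σ = σ} ρ (⇓else {e} {n = n} e≡nil r) =
  let _ , r′ , le = frame-run ρ r in
  _ , ⇓else (trans (eval-frameExp e σ ρ) e≡nil) r′ ,
  ≤-trans (+-mono-≤ (m+n≤o⇒n≤o 3 (frame-test e)) le) (≤-reflexive (sym (*-distribˡ-+ 4 (suc (cost e)) n)))
frame-run {σ = σ} ρ (⇓stop {e} e≡nil) =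
  _ , ⇓stop (trans (eval-frameExp e σ ρ) e≡nil) , m+n≤o⇒n≤o 3 (frame-test e)
frame-run {σ = σ} ρ (⇓loop {e} {m = m} {n} e≢nil r s) =
  let _ , r′ , le = frame-run ρ r
      _ , s′ , le′ = frame-run ρ s in
  _ , ⇓loop (e≢nil ∘ trans (sym (eval-frameExp e σ ρ))) r′ s′ ,
  ≤-trans (+-mono-≤ (m+n≤o⇒n≤o 3 (frame-test e)) (+-mono-≤ le le′))
          (≤-reflexive (lemma (suc (cost e)) m n))
  where
  lemma : ∀ a b c → 4 * a + (4 * b + 4 * c) ≡ 4 * (a + (b + c))
  lemma = solve-∀

frame-poly : ∀ {A : Set} {ℓ : A → ℕ} {p σ τ} (ρ : A → Tree) → PolyTime ℓ p σ τ →
             PolyTime ℓ (frame p) (λ a → cons (σ a) (ρ a)) (λ a → cons (τ a) (ρ a))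
frame-poly ρ (polyTime f r) = polyTime (≼-* (≼-const 4) f) λ a →
  let _ , run , n≤ = r a in weaken (*-monoʳ-≤ 4 n≤) (frame-run (ρ a) run)

-- At most i rounds, each of time at most B.
data Loop (e : Exp) (c : Cmd) (B : ℕ) : ℕ → Tree → Tree → Set where
  done  : ∀ {i σ} → eval e σ ≡ nil → Loop e c B i σ σ
  round : ∀ {i σ τ υ} → eval e σ ≢ nil → c ⊢ σ ⇓ τ within B →
          Loop e c B i τ υ → Loop e c B (suc i) σ υ

-- The additional round in `suc i` pays for the final, failing test.
loop-run : ∀ {e c B i σ τ} → Loop e c B i σ τ → while e c ⊢ σ ⇓ τ within (suc i * (suc (cost e) + B))
loop-run {e} {B = B} (done e≡nil) = _ , ⇓stop e≡nil , ≤-trans (m≤m+n (suc (cost e)) B) (m≤m+n _ _)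
loop-run {e} {B = B} (round e≢nil (_ , r , m≤B) l) =
  let _ , s , n≤ = loop-run l in
  _ , ⇓loop e≢nil r s ,
  ≤-trans (≤-reflexive (sym (+-assoc (suc (cost e)) _ _))) (+-mono-≤ (+-monoʳ-≤ (suc (cost e)) m≤B) n≤)

loop-poly : ∀ {A : Set} {ℓ : A → ℕ} {e c σ τ} {B i : A → ℕ} → B ≼ ℓ → i ≼ ℓ →
            (∀ a → Loop e c (B a) (i a) (σ a) (τ a)) → PolyTime ℓ (while e c) σ τ
loop-poly {e = e} B≼ i≼ l =
  polyTime (≼-* (≼-+ (≼-const 1) i≼) (≼-+ (≼-const (suc (cost e))) B≼)) (loop-run ∘ l)

-- Sizes of encodings

size-unary : ∀ n → size (encodeUnary n) ≡ 1 + 2 * n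
size-unary zero    = refl
size-unary (suc n) = trans (cong (2 +_) (size-unary n)) (lemma n)
  where
  lemma : ∀ n → 2 + (1 + 2 * n) ≡ 1 + 2 * (1 + n)
  lemma = solve-∀

size-list : ∀ {A : Set} {f : A → Tree} {b} → (∀ a → size (f a) ≤ b) →
            ∀ as → size (encodeList f as) ≤ 1 + length as * suc b
size-list f≤b []       = ≤-refl
size-list f≤b (a ∷ as) =
  s≤s (≤-trans (+-mono-≤ (f≤b a) (size-list f≤b as)) (≤-reflexive (+-suc _ _)))

size-bits : ∀ x → size (encodeBits x) ≤ 1 + length x * 4
size-bits = size-list λ where
  false → s≤s z≤n
  true  → ≤-refl

length≤size-bits : ∀ x → length x ≤ size (encodeBits x)
length≤size-bits []      = z≤n
length≤size-bits (b ∷ x) = s≤s (≤-trans (length≤size-bits x) (m≤n+m _ (size (encodeBool b))))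

record PolySize {A : Set} (ℓ : A → ℕ) (σ : A → Tree) : Set where
  constructor polySize
  field
    size≼ : size ∘ σ ≼ ℓ

open PolySize

module _ {A : Set} {ℓ : A → ℕ} where

  const-size : ∀ τ → PolySize ℓ (λ _ → τ)
  const-size τ = polySize (≼-const (size τ))

  cons-size : {σ τ : A → Tree} → PolySize ℓ σ → PolySize ℓ τ → PolySize ℓ (λ a → cons (σ a) (τ a))
  cons-size (polySize p) (polySize q) = polySize (≼-+ {f = λ _ → 1} (≼-const 1) (≼-+ p q))

  unary-size : (n : A → ℕ) → n ≼ ℓ → PolySize ℓ (encodeUnary ∘ n)
  unary-size n p = polySize (≼-mono (λ a → ≤-reflexive (size-unary (n a)))
                                    (≼-+ (≼-const 1) (≼-* (≼-const 2) p)))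

  bits-size : (x : A → List Bool) → length ∘ x ≼ ℓ → PolySize ℓ (encodeBits ∘ x)
  bits-size x p = polySize (≼-mono (size-bits ∘ x) (≼-+ (≼-const 1) (≼-* p (≼-const 4))))

-- Computing a polynomial in unary

sucs : ℕ → Exp → Exp
sucs zero    e = e
sucs (suc n) e = pair (const nil) (sucs n e)

eval-sucs : ∀ n e {σ a} → eval e σ ≡ encodeUnary a → eval (sucs n e) σ ≡ encodeUnary (n + a)
eval-sucs zero    e eq = eq
eval-sucs (suc n) e eq = cong (cons nil) (eval-sucs n e eq)

-- Multiplication by `length x` is iteration: a copy of the bits of `x` is consumed as a loop
-- counter, while the program for the lower power runs on the head of the store.
addPower : ℕ → ℕ → Cmd
addPowerBody : ℕ → ℕ → Cmd

addPower c zero    = assign (pair (hd var) (sucs c (tl var)))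
addPower c (suc k) =
  assign (pair var (hd var)) ⨾ while (tl var) (addPowerBody c k) ⨾ assign (hd var)

addPowerBody c k = frame (addPower c k) ⨾ assign (pair (hd var) (tl (tl var)))

addPower-poly : ∀ c k → PolyTime (length ∘ proj₁) (addPower c k)
  (λ (x , n) → cons (encodeBits x) (encodeUnary n))
  (λ (x , n) → cons (encodeBits x) (encodeUnary (c * length x ^ k + n)))
addPower-poly c zero    = assign-poly _ λ (x , n) →
  cong (cons (encodeBits x)) (trans (eval-sucs c (tl var) refl)
                                    (cong (λ c → encodeUnary (c + n)) (sym (*-identityʳ c))))
addPower-poly c (suc k) =
  assign-poly _ (λ _ → refl) ⨾-poly
  loop-poly {B = budget ∘ proj₁} (poly degree λ _ → ≤-refl) ≼-refl
    (λ (x , n) → loop x x n (lemma₁ (length x) c (length x ^ k) n)) ⨾-poly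
  assign-poly _ λ _ → refl
  where
  body-poly : PolyTime (λ (x , _) → length x) (addPowerBody c k)
    (λ (x , b , y , n) → cons (cons (encodeBits x) (encodeUnary n)) (encodeBits (b ∷ y)))
    (λ (x , b , y , n) → cons (cons (encodeBits x) (encodeUnary (c * length x ^ k + n))) (encodeBits y))
  body-poly =
    frame-poly (λ (_ , b , y , _) → encodeBits (b ∷ y))
      (reindex (λ (x , _ , _ , n) → x , n) ≼-refl (addPower-poly c k)) ⨾-poly
    assign-poly _ λ _ → refl

  open PolyTime body-poly
  open _≼_ feasible

  -- The time of a round may vary with the counter and the remaining bits, but its polynomial bound
  -- depends on `x` alone, so one budget serves all rounds.
  budget : List Bool → ℕ
  budget x = (2 + length x) ^ degree

  lemma₁ : ∀ l a b n → l * (a * b) + n ≡ a * (l * b) + n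
  lemma₁ = solve-∀

  lemma₂ : ∀ l a b n → l * (a * b) + (a * b + n) ≡ suc l * (a * b) + n
  lemma₂ = solve-∀

  -- Invariant: the counter plus what the remaining bits will still add is the final value `m`.
  loop : ∀ x y n {m} → length y * (c * length x ^ k) + n ≡ m →
         Loop (tl var) (addPowerBody c k) (budget x) (length y)
              (cons (cons (encodeBits x) (encodeUnary n)) (encodeBits y))
              (cons (cons (encodeBits x) (encodeUnary m)) nil)
  loop x []      n refl = done refl
  loop x (b ∷ y) n eq   = round (λ ()) (weaken (bounded (x , b , y , n)) (run (x , b , y , n)))
    (loop x y _ (trans (lemma₂ (length y) c (length x ^ k) n) eq))

-- Witnesses as sets of links

-- A witness y is coded by the bits 1…1 0 1 y with at least one leading 1.
-- The 1 after the 0 ensures that the coding set has two links, even if y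
-- is all zeros.
decode : List Bool → List Bool
decode = List.drop 2 ∘ List.dropWhileᵇ id

length-dropWhileᵇ : ∀ {A : Set} (p : A → Bool) xs → length (List.dropWhileᵇ p xs) ≤ length xs
length-dropWhileᵇ p []       = z≤n
length-dropWhileᵇ p (x ∷ xs) with p x
... | true  = m≤n⇒m≤1+n (length-dropWhileᵇ p xs)
... | false = ≤-refl

-- The leading 1 is always skipped and two further bits are dropped. Hence any set containing the
-- link of the source, coding or not, reads as a witness within the length bound.
length-decode : ∀ {m} (S : Subset (2 + m)) → length (decode (Vec.toList (inside ∷ S))) ≤ m
length-decode S = ≤-trans (≤-reflexive (length-drop 2 (List.dropWhileᵇ id (Vec.toList S))))
  (∸-monoˡ-≤ 2 (≤-trans (length-dropWhileᵇ id (Vec.toList S)) (≤-reflexive (length-toList S))))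

-- The slack `m ∸ length y` is filled with leading ones, so witnesses of all admissible lengths fit
-- into sets over the same links.
code : ∀ {m} y → length y ≤ m →
       ∃[ S ] 1 ≤ ∣ S ∣ × decode (Vec.toList {n = 3 + m} (inside ∷ S)) ≡ y
code {m} y |y|≤m = subst
  (λ n → ∃[ S ] 1 ≤ ∣ S ∣ × decode (Vec.toList {n = suc n} (inside ∷ S)) ≡ y)
  length≡ (pad (m ∸ length y))
  where
  pad : ∀ d → ∃[ S ] 1 ≤ ∣ S ∣ × decode (Vec.toList {n = suc (d + (2 + length y))} (inside ∷ S)) ≡ y
  pad zero    = outside ∷ inside ∷ Vec.fromList y , s≤s z≤n , toList∘fromList y
  pad (suc d) = let S , _ , eq = pad d in inside ∷ S , s≤s z≤n , eq

  length≡ : m ∸ length y + (2 + length y) ≡ 2 + m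
  length≡ = trans (lemma (m ∸ length y) (length y)) (cong (2 +_) (m∸n+n≡m |y|≤m))
    where
    lemma : ∀ a b → a + (2 + b) ≡ 2 + (a + b)
    lemma = solve-∀

-- Running the verifier on a coded witness

check : Cmd → Cmd
check V =
  -- The loop also stops at the empty list, since `hd` sends `nil` to `nil`, which is the code of
  -- `false`.
  while (hd (tl var)) (assign (pair (hd var) (tl (tl var)))) ⨾
  assign (pair (hd var) (tl (tl (tl var)))) ⨾
  V

check-poly : ∀ {V out} → PolyTime (size ∘ encodeBitsPair) V encodeBitsPair out →
  PolyTime (λ (x , l) → length x + length l) (check V) encodeBitsPair (λ (x , l) → out (x , decode l))
check-poly V-poly =
  loop-poly {B = λ _ → 7} (≼-const 7) (≼-mono (λ (x , l) → m≤n+m (length l) (length x)) ≼-refl)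
    (λ (x , l) → skip x l) ⨾-poly
  assign-poly _ (λ (x , l) → cong (cons (encodeBits x)) (drop-two (List.dropWhileᵇ id l))) ⨾-poly
  reindex (λ (x , l) → x , decode l)
    (PolySize.size≼ (cons-size
      (bits-size proj₁ (≼-mono (λ (x , l) → m≤m+n (length x) (length l)) ≼-refl))
      (bits-size (decode ∘ proj₂) (≼-mono length-decode≤ ≼-refl))))
    V-poly
  where
  skip : ∀ x l → Loop _ _ 7 (length l) (encodeBitsPair (x , l)) (encodeBitsPair (x , List.dropWhileᵇ id l))
  skip x []          = done refl
  skip x (false ∷ l) = done refl
  skip x (true ∷ l)  = round (λ ()) (within-assign refl) (skip x l)

  -- On lists with fewer than two bits, `tail nil = nil` agrees with the truncation in `List.drop`.
  drop-two : ∀ l → tail (tail (encodeBits l)) ≡ encodeBits (List.drop 2 l)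
  drop-two []          = refl
  drop-two (_ ∷ [])    = refl
  drop-two (_ ∷ _ ∷ l) = refl

  length-decode≤ : ∀ ((x , l) : List Bool × List Bool) → length (decode l) ≤ length x + length l
  length-decode≤ (x , l) = begin
    length (decode l)                     ≡⟨ length-drop 2 (List.dropWhileᵇ id l) ⟩
    length (List.dropWhileᵇ id l) ∸ 2     ≤⟨ m∸n≤m _ 2 ⟩
    length (List.dropWhileᵇ id l)         ≤⟨ length-dropWhileᵇ id l ⟩
    length l                              ≤⟨ m≤n+m (length l) (length x) ⟩
    length x + length l                   ∎
    where open ≤-Reasoning

-- Sizes of the components of an encoded network

size-replicate : ∀ {A : Set} (f : A → Tree) n a →
                 size (encodeList f (Vec.toList (Vec.replicate n a))) ≡ 1 + n * suc (size (f a))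
size-replicate f zero    a = refl
size-replicate f (suc n) a = cong suc (trans (cong (size (f a) +_) (size-replicate f n a)) (+-suc _ _))

size-node : ∀ {n} (i : Fin n) → size (encodeNode i) ≤ 1 + 2 * n
size-node i = ≤-trans (≤-reflexive (size-unary (toℕ i))) (s≤s (*-monoʳ-≤ 2 (<⇒≤ (toℕ<n i))))

size-link : ∀ {n} (l : Fin n × Fin n) → size (encodeLink l) ≤ 1 + ((1 + 2 * n) + (1 + 2 * n))
size-link (u , v) = s≤s (+-mono-≤ (size-node u) (size-node v))

-- Star networks

-- Indexing by numbers instead of `Fin` matches the way in which a program builds these lists with a
-- unary counter.
range : (ℕ → Tree) → ℕ → ℕ → Tree
range F i zero    = nil
range F i (suc n) = cons (F i) (range F (suc i) n)

encode-tabulate : ∀ {A : Set} {f : A → Tree} {F n} i (g : Fin n → A) →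
                  (∀ j → f (g j) ≡ F (toℕ j + i)) → encodeList f (Vec.toList (Vec.tabulate g)) ≡ range F i n
encode-tabulate {n = zero}      i g eq = refl
encode-tabulate {F = F} {suc n} i g eq = cong₂ cons (eq zero)
  (encode-tabulate (suc i) (g ∘ suc) λ j → trans (eq (suc j)) (cong F (sym (+-suc (toℕ j) i))))

encode-replicate : ∀ {A : Set} {f : A → Tree} n i (a : A) →
                   encodeList f (Vec.toList (Vec.replicate n a)) ≡ range (λ _ → f a) i n
encode-replicate zero    i a = refl
encode-replicate (suc n) i a = cong (cons _) (encode-replicate n (suc i) a)

spoke : ∀ {n} → Fin n → Fin (suc n) × Fin (suc n)
spoke j = suc j , zero

spoke-injective : ∀ {n} {i j : Fin n} → spoke i ≡ spoke j → i ≡ j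
spoke-injective refl = refl

spokeTree weightTree : ℕ → Tree
spokeTree j  = cons (encodeUnary (suc j)) nil
weightTree _ = encodeℚ 0ℚ

listSpokesBody : Cmd
listSpokesBody =
  assign (pair (tl (hd var))
         (pair (pair (pair (hd var) (const nil)) (hd (tl var)))
         (pair (pair (const (encodeℚ 0ℚ)) (hd (tl (tl var))))
               (tl (tl (tl var))))))

-- Consing extends a list at the front, so the lists are filled from the back. When the counter is
-- `suc i`, spoke `i` is added; it starts at node `suc i`, so the counter itself encodes that node.
-- One round costs 25.
listSpokes-loop : ∀ i n {k} τ → i + n ≡ k → Loop (hd var) listSpokesBody 25 i
  (cons (encodeUnary i) (cons (range spokeTree i n) (cons (range weightTree i n) τ)))
  (cons nil             (cons (range spokeTree 0 k) (cons (range weightTree 0 k) τ)))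
listSpokes-loop zero    n τ refl = done refl
listSpokes-loop (suc i) n τ refl =
  round (λ ()) (within-assign refl) (listSpokes-loop i (suc n) τ (+-suc i n))

star : ∀ n → (ρ : Subset (suc n) → ℚ) → (∀ S → 1 ℕ.< ∣ S ∣ → 0ℚ < ρ S) → Network
star n ρ ρ>0 = record
  { N        = 2 + n
  ; L        = suc n
  ; links    = Vec.tabulate spoke
  ; distinct = tabulate⁺ spoke-injective
  ; w        = 1ℚ ∷ Vec.replicate n 0ℚ
  ; w≥0      = λ where
      zero    → ℚ.nonNegative⁻¹ 1ℚ
      (suc l) → ℚ.≤-reflexive (sym (lookup-replicate l 0ℚ))
  ; ρ        = ρ
  ; ρ>0      = ρ>0
  }

jointCost-single : ∀ G S → ∣ S ∣ ≤ 1 → jointCost G S ≡ total S (Network.w G)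
jointCost-single G S |S|≤1 with ∣ S ∣
... | 0           = refl
... | 1           = refl
... | suc (suc _) with s≤s () ← |S|≤1

jointCost-many : ∀ G S → 1 ℕ.< ∣ S ∣ → jointCost G S ≡ Network.ρ G S ℚ.* total S (Network.w G)
jointCost-many G S 1<|S| with ∣ S ∣
... | suc (suc _) = refl
... | 1 with s≤s () ← 1<|S|

total-zero : ∀ {n} (S : Subset n) → total S (Vec.replicate n 0ℚ) ≡ 0ℚ
total-zero []            = refl
total-zero (inside  ∷ S) = trans (ℚ.+-identityˡ _) (total-zero S)
total-zero (outside ∷ S) = total-zero S

total-star : ∀ {n} (S : Subset n) → total (inside ∷ S) (1ℚ ∷ Vec.replicate n 0ℚ) ≡ 1ℚ
total-star S = cong (1ℚ ℚ.+_) (total-zero S)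

module _ {n} {ρ : Subset (suc n) → ℚ} {ρ>0 : ∀ S → 1 ℕ.< ∣ S ∣ → 0ℚ < ρ S} where

  private
    G : Network
    G = star n ρ ρ>0

  jointCost-star-single : ∀ S → ∣ inside ∷ S ∣ ≤ 1 → jointCost G (inside ∷ S) ≡ 1ℚ
  jointCost-star-single S |S|≤1 = trans (jointCost-single G (inside ∷ S) |S|≤1) (total-star S)

  jointCost-star-many : ∀ S → 1 ℕ.< ∣ inside ∷ S ∣ → jointCost G (inside ∷ S) ≡ ρ (inside ∷ S)
  jointCost-star-many S 1<|S| = begin
    jointCost G (inside ∷ S)                       ≡⟨ jointCost-many G (inside ∷ S) 1<|S| ⟩
    ρ (inside ∷ S) ℚ.* total (inside ∷ S) (Network.w G)
                                                   ≡⟨ cong (ρ (inside ∷ S) ℚ.*_) (total-star S) ⟩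
    ρ (inside ∷ S) ℚ.* 1ℚ                          ≡⟨ ℚ.*-identityʳ _ ⟩
    ρ (inside ∷ S)                                 ∎
    where open ≡-Reasoning

  -- All spokes end at the target, which lies outside, so a spoke is cut exactly when its other end
  -- lies in the chosen set.
  cutLinks-star : ∀ (S : Subset (suc n)) →
    Vec.map (λ (u , v) → lookup (outside ∷ S) u ∧ not (lookup (outside ∷ S) v)) (Vec.tabulate spoke) ≡ S
  cutLinks-star S = begin
    Vec.map _ (Vec.tabulate spoke)                  ≡⟨ sym (tabulate-∘ _ spoke) ⟩
    Vec.tabulate (λ j → lookup S j ∧ true)          ≡⟨ tabulate-cong (λ j → ∧-identityʳ (lookup S j)) ⟩
    Vec.tabulate (lookup S)                         ≡⟨ tabulate∘lookup S ⟩
    S                                               ∎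
    where open ≡-Reasoning

  starCut : Subset n → Cut G (suc zero) zero
  starCut S = record { X = outside ∷ inside ∷ S ; s∈X = there here ; t∉X = λ () }

  cutCost-starCut : ∀ S → Cut.cutCost (starCut S) ≡ jointCost G (inside ∷ S)
  cutCost-starCut S = cong (jointCost G) (cutLinks-star (inside ∷ S))

  star-cut : ∀ (C : Cut G (suc zero) zero) → ∃[ S ]
             Cut.X C ≡ outside ∷ inside ∷ S × Cut.cutCost C ≡ jointCost G (inside ∷ S)
  star-cut record { X = inside ∷ _ ; t∉X = t∉X } = contradiction here t∉X
  star-cut record { X = outside ∷ outside ∷ _ ; s∈X = there () }
  star-cut record { X = outside ∷ inside ∷ S } =
    S , refl , cong (jointCost G) (cutLinks-star (inside ∷ S))

-- The ratio between rejecting and accepting cuts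

module Gap (α : ℚ) (1<α : 1ℚ < α) where

  instance
    α-positive : ℚ.Positive α
    α-positive = ℚ.positive (ℚ.<-trans (ℚ.positive⁻¹ 1ℚ) 1<α)

    α-nonZero : ℚ.NonZero α
    α-nonZero = ℚ.pos⇒nonZero α

    α-nonNegative : ℚ.NonNegative α
    α-nonNegative = ℚ.pos⇒nonNeg α

  -- An approximate solution may then cost at most ½ whenever a witness exists, which is below both
  -- other possible costs: 1 for a single link and 2 for a rejected set.
  ε : ℚ
  ε = ℚ.1/ α ℚ.* ½

  α*ε≡½ : α ℚ.* ε ≡ ½
  α*ε≡½ = begin
    α ℚ.* (ℚ.1/ α ℚ.* ½)   ≡⟨ sym (ℚ.*-assoc α (ℚ.1/ α) ½) ⟩
    α ℚ.* ℚ.1/ α ℚ.* ½     ≡⟨ cong (ℚ._* ½) (ℚ.*-inverseʳ α) ⟩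
    1ℚ ℚ.* ½               ≡⟨ ℚ.*-identityˡ ½ ⟩
    ½                      ∎
    where open ≡-Reasoning

  ε>0 : 0ℚ < ε
  ε>0 = ℚ.positive⁻¹ ε {{ℚ.pos*pos⇒pos (ℚ.1/ α) {{ℚ.1/pos⇒pos α}} ½}}

  ε≢1 : ε ≢ 1ℚ
  ε≢1 ε≡1 = ℚ.<-asym 1<α (subst (_< 1ℚ) ½≡α (from-yes (½ ℚ.<? 1ℚ)))
    where
    ½≡α : ½ ≡ α
    ½≡α = trans (sym α*ε≡½) (trans (cong (α ℚ.*_) ε≡1) (ℚ.*-identityʳ α))

  2ℚ : ℚ
  2ℚ = 1ℚ ℚ.+ 1ℚ

  correlation : Tree → ℚ
  correlation nil        = 2ℚ
  correlation (cons _ _) = ε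

  correlation>0 : ∀ τ → 0ℚ < correlation τ
  correlation>0 nil        = ℚ.positive⁻¹ 2ℚ
  correlation>0 (cons _ _) = ε>0

  -- This makes every star a legitimate instance with correlated links, whatever the verifier
  -- answers. Rejection is given the value 2 and not 1 for this reason.
  correlation≢1 : ∀ τ → correlation τ ≢ 1ℚ
  correlation≢1 nil        = λ ()
  correlation≢1 (cons _ _) = ε≢1

  correlation-accept : ∀ {τ} → τ ≢ nil → correlation τ ≡ ε
  correlation-accept {nil}      τ≢nil = contradiction refl τ≢nil
  correlation-accept {cons _ _} τ≢nil = refl

  correlation≤½ : ∀ {τ} → correlation τ ℚ.≤ ½ → τ ≢ nil
  correlation≤½ 2≤½ refl = from-no (2ℚ ℚ.≤? ½) 2≤½

-- A verifier V for witnesses of length at most bound c k n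

module Reduction
  (α : ℚ) (1<α : 1ℚ < α) (c k : ℕ)
  {V : Cmd} {out : List Bool × List Bool → Tree}
  (V-poly : PolyTime (size ∘ encodeBitsPair) V encodeBitsPair out)
  where

  open Gap α 1<α

  -- The three links beyond the witness bits carry a leading 1, for the link of the source, and the
  -- separators 0 and 1.
  witnessBound links# : List Bool → ℕ
  witnessBound x = bound c k (length x)
  links# x = 3 + witnessBound x

  witnessBound≼ : witnessBound ≼ length
  witnessBound≼ = ≼-bound c k ≼-refl

  links#≼ : links# ≼ length
  links#≼ = ≼-+ (≼-const 3) witnessBound≼

  ρ : ∀ x → Subset (links# x) → ℚ
  ρ x S = correlation (out (x , decode (Vec.toList S)))

  judge : Cmd
  judge = check V ⨾ cond var (assign (const (encodeℚ ε))) (assign (const (encodeℚ 2ℚ)))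

  ρ-program : List Bool → Cmd
  ρ-program x = assign (pair (const (encodeBits x)) var) ⨾ judge

  module _ {A : Set} {ℓ : A → ℕ} (x l : A → List Bool) where

    check-poly′ : length ∘ x ≼ ℓ → length ∘ l ≼ ℓ → PolyTime ℓ (check V)
      (λ a → encodeBitsPair (x a , l a)) (λ a → out (x a , decode (l a)))
    check-poly′ p q = reindex (λ a → x a , l a) (≼-+ p q) (check-poly V-poly)

  SubsetInput : Set
  SubsetInput = Σ[ x ∈ List Bool ] Subset (links# x)

  judge-poly : PolyTime (length ∘ proj₁) judge
    (λ ((x , S) : SubsetInput) → encodeBitsPair (x , Vec.toList S)) (λ (x , S) → encodeℚ (ρ x S))
  judge-poly =
    check-poly′ proj₁ (λ (_ , S) → Vec.toList S) ≼-refl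
      (≼-mono (λ (_ , S) → ≤-reflexive (length-toList S)) (≼-∘ proj₁ links#≼)) ⨾-poly
    polyTime (≼-const 4) λ (x , S) → choose (out (x , decode (Vec.toList S)))
    where
    choose : ∀ τ → cond var (assign (const (encodeℚ ε))) (assign (const (encodeℚ 2ℚ)))
                   ⊢ τ ⇓ encodeℚ (correlation τ) within 4
    choose nil        = _ , ⇓else refl ⇓assign , ≤-refl
    choose (cons _ _) = _ , ⇓then (λ ()) ⇓assign , ≤-refl

  -- The instance contains its time bound in unary, so the bound is brought into the explicit form
  -- that `addPower` can compute from `x`.
  ρ-computable : ∃[ c′ ] ∃[ k′ ] (∀ x S →
    ρ-program x ⊢ encodeSubset S ⇓ encodeℚ (ρ x S) within bound c′ k′ (length x))
  ρ-computable =
    let open PolyTime judge-poly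
        c′ , k′ , time≤ = ≼⇒bound (≼-+ (≼-const 4) feasible) in
    c′ , k′ , λ x S → weaken (time≤ (x , S)) (within-⨾ (within-assign refl) (run (x , S)))

  -- With c′ and k′ as variables, the time bound does not unfold to the large
  -- term that ρ-computable gives for it.
  module Construction (c′ k′ : ℕ)
    (ρ-computed : ∀ x S → ρ-program x ⊢ encodeSubset S ⇓ encodeℚ (ρ x S) within bound c′ k′ (length x))
    where

    ρ-time : List Bool → ℕ
    ρ-time x = bound c′ k′ (length x)

    ρ-time≼ : ρ-time ≼ length
    ρ-time≼ = ≼-bound c′ k′ ≼-refl

    network : List Bool → Network
    network x = star _ (ρ x) λ S _ → correlation>0 (out (x , decode (Vec.toList S)))

    inst : List Bool → Instance
    inst x = record
      { G          = network x
      ; correlated = Subset.⊤ , s≤s (s≤s z≤n) ,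
                     correlation≢1 (out (x , decode (Vec.toList {n = links# x} Subset.⊤)))
      ; s          = suc zero
      ; t          = zero
      ; s≢t        = λ ()
      ; ρ-program  = ρ-program x
      ; ρ-time     = ρ-time x
      ; ρ-computed = λ S _ → ρ-computed x S
      }

    -- Building the encoded instance

    linksTree weightsTree programTree instanceTree : List Bool → Tree
    linksTree x    = range spokeTree 0 (links# x)
    weightsTree x  = cons (encodeℚ 1ℚ) (range weightTree 1 (2 + witnessBound x))
    programTree x  = encodeCmd (ρ-program x)
    instanceTree x = cons (encodeUnary (suc (links# x))) (cons (linksTree x) (cons (weightsTree x)
      (cons (encodeUnary 1) (cons nil (cons (programTree x) (encodeUnary (ρ-time x)))))))

    encode-inst : ∀ x → encodeInstance (inst x) ≡ instanceTree x
    encode-inst x = cong (cons _) (cong₂ cons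
      (encode-tabulate {F = spokeTree} 0 spoke λ j → cong spokeTree (sym (+-identityʳ (toℕ j))))
      (cong₂ cons (cong (cons _) (encode-replicate {f = encodeℚ} (2 + witnessBound x) 1 0ℚ)) refl))

    -- After the loop the store is (nil . links . weights . x . ρ-time . links#),
    -- all weights being 0; the first one is replaced by 1 in the end.
    build : Cmd
    build =
      assign (pair var (const (encodeUnary c))) ⨾
      addPower c k ⨾
      assign (pair (pair (hd var) (const (encodeUnary c′))) var) ⨾
      frame (addPower c′ k′) ⨾
      assign (pair l (pair (const nil) (pair (const nil) (pair (hd (hd var)) (pair (tl (hd var)) l))))) ⨾
      while (hd var) listSpokesBody ⨾
      assign (pair instanceExp x)
      where
      l x t l′ programExp instanceExp : Exp
      l  = sucs 3 (tl (tl var))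
      x  = hd (tl (tl (tl var)))
      t  = hd (tl (tl (tl (tl var))))
      l′ = tl (tl (tl (tl (tl var))))
      -- This assembles the code of `ρ-program x`. The tags 1, 0 and 2 stand for sequencing,
      -- assignment and pairing; the tag 1 in front of `x` turns the stored bits into a constant of
      -- the program.
      programExp = pair (const (encodeUnary 1)) (pair
        (pair (const (encodeUnary 0)) (pair (const (encodeUnary 2))
          (pair (pair (const (encodeUnary 1)) x) (const (encodeExp var)))))
        (const (encodeCmd judge)))
      instanceExp = pair (sucs 1 l′) (pair (hd (tl var))
        (pair (pair (const (encodeℚ 1ℚ)) (tl (hd (tl (tl var)))))
        (pair (const (encodeUnary 1)) (pair (const nil) (pair programExp t)))))

    build-poly : PolyTime length build encodeBits (λ x → cons (encodeInstance (inst x)) (encodeBits x))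
    build-poly =
      assign-poly _ (λ _ → refl) ⨾-poly
      -- Starting the counter at `c` supplies the additive constant of `bound c k`.
      reindex (λ x → x , c) ≼-refl (addPower-poly c k) ⨾-poly
      assign-poly _ (λ _ → refl) ⨾-poly
      frame-poly (λ x → cons (encodeBits x) (encodeUnary (witnessBound x)))
        (reindex (λ x → x , c′) ≼-refl (addPower-poly c′ k′)) ⨾-poly
      assign-poly _ (λ _ → refl) ⨾-poly
      loop-poly {B = λ _ → 25} (≼-const 25) links#≼ (λ x → listSpokes-loop (links# x) 0
        (cons (encodeBits x) (cons (encodeUnary (ρ-time x)) (encodeUnary (links# x))))
        (+-identityʳ (links# x))) ⨾-poly
      assign-poly _ (λ x → cong (λ τ → cons τ (encodeBits x)) (sym (encode-inst x)))

    -- The approximation algorithm is polynomial in the size of the instance; this converts its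
    -- running time into a polynomial in `length x`.
    instance-size : PolySize length (encodeInstance ∘ inst)
    instance-size =
      cons-size (unary-size (λ x → suc (links# x)) nodes#≼) (
      cons-size links-size (
      cons-size weights-size (
      cons-size (const-size (encodeUnary 1)) (
      cons-size (const-size nil) (
      cons-size program-size
                (unary-size ρ-time ρ-time≼))))))
      where
      nodes#≼ : (λ x → suc (links# x)) ≼ length
      nodes#≼ = ≼-+ (≼-const 1) links#≼

      linkBound : List Bool → ℕ
      linkBound x = 1 + ((1 + 2 * suc (links# x)) + (1 + 2 * suc (links# x)))

      linkBound≼ : linkBound ≼ length
      linkBound≼ = ≼-+ (≼-const 1) (≼-+ node-size node-size)
        where
        node-size : (λ x → 1 + 2 * suc (links# x)) ≼ length
        node-size = ≼-+ (≼-const 1) (≼-* (≼-const 2) nodes#≼)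

      links-size : PolySize length (λ x → encodeList encodeLink (Vec.toList (Network.links (network x))))
      links-size = polySize (≼-mono
        (λ x → ≤-trans (size-list {f = encodeLink} size-link (Vec.toList (Network.links (network x))))
          (≤-reflexive (cong (λ n → 1 + n * suc (linkBound x)) (length-toList (Network.links (network x))))))
        (≼-+ (≼-const 1) (≼-* links#≼ (≼-+ (≼-const 1) linkBound≼))))

      weights-size : PolySize length (λ x → encodeList encodeℚ (Vec.toList (Network.w (network x))))
      weights-size = cons-size (const-size (encodeℚ 1ℚ)) (polySize (≼-mono
        (λ x → ≤-reflexive (size-replicate encodeℚ (2 + witnessBound x) 0ℚ))
        (≼-+ (≼-const 1) (≼-* (≼-+ (≼-const 2) witnessBound≼) (≼-const (suc (size (encodeℚ 0ℚ))))))))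

      program-size : PolySize length (λ x → encodeCmd (ρ-program x))
      program-size = cons-size (const-size (encodeUnary 1)) (cons-size
        (cons-size (const-size nil) (cons-size (const-size (encodeUnary 2)) (cons-size
          (cons-size (const-size (encodeUnary 1)) (bits-size id ≼-refl)) (const-size (encodeExp var)))))
        (const-size (encodeCmd judge)))

    -- From approximate cuts to accepted witnesses

    approximate-accepted : ∀ x {y} → length y ≤ witnessBound x → out (x , y) ≢ nil →
      (C : Cut (network x) (suc zero) zero) (opt : ℚ) → IsMinCutCost (network x) (suc zero) zero opt →
      Cut.cutCost C ℚ.≤ α ℚ.* opt →
      out (x , decode (Vec.toList (inside ∷ proj₁ (star-cut C)))) ≢ nil
    approximate-accepted x {y} |y|≤ accepted C opt (_ , opt≤) cost≤ = by-size (∣ inside ∷ S ∣ ≤? 1)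
      where
      S = proj₁ (star-cut C)
      Sʸ = proj₁ (code y |y|≤)

      cost-Sʸ≡ε : Cut.cutCost (starCut Sʸ) ≡ ε
      cost-Sʸ≡ε = let _ , 1≤|Sʸ| , decode≡y = code y |y|≤ in begin
        Cut.cutCost (starCut Sʸ)                               ≡⟨ cutCost-starCut Sʸ ⟩
        jointCost (network x) (inside ∷ Sʸ)                    ≡⟨ jointCost-star-many Sʸ (s≤s 1≤|Sʸ|) ⟩
        ρ x (inside ∷ Sʸ)                                      ≡⟨ cong (λ y → correlation (out (x , y))) decode≡y ⟩
        correlation (out (x , y))                              ≡⟨ correlation-accept accepted ⟩
        ε                                                      ∎
        where open ≡-Reasoning

      cost≤½ : jointCost (network x) (inside ∷ S) ℚ.≤ ½
      cost≤½ = begin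
        jointCost (network x) (inside ∷ S)  ≡⟨ sym (proj₂ (proj₂ (star-cut C))) ⟩
        Cut.cutCost C                       ≤⟨ cost≤ ⟩
        α ℚ.* opt                           ≤⟨ ℚ.*-monoˡ-≤-nonNeg α (opt≤ (starCut Sʸ)) ⟩
        α ℚ.* Cut.cutCost (starCut Sʸ)      ≡⟨ cong (α ℚ.*_) cost-Sʸ≡ε ⟩
        α ℚ.* ε                             ≡⟨ α*ε≡½ ⟩
        ½                                   ∎
        where open ℚ.≤-Reasoning

      by-size : Dec (∣ inside ∷ S ∣ ≤ 1) → out (x , decode (Vec.toList (inside ∷ S))) ≢ nil
      -- The link of the source alone would cost 1, more than the permitted ½.
      by-size (yes |S|≤1) = contradiction (subst (ℚ._≤ ½) (jointCost-star-single S |S|≤1) cost≤½)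
                                          (from-no (1ℚ ℚ.≤? ½))
      by-size (no |S|≰1)  = correlation≤½ (subst (ℚ._≤ ½) (jointCost-star-many S (≰⇒> |S|≰1)) cost≤½)

    -- Framing keeps `x` beside the instance while `p` runs. Dropping the first bit of the returned
    -- node set, that of the target, leaves the link set that codes the witness.
    decide : Cmd → Cmd
    decide p = build ⨾ frame p ⨾ assign (pair (tl var) (tl (hd var))) ⨾ check V

    module _ {p : Cmd} (approximates : ApproximatesMCDCM α p) where

      private
        solution = proj₁ (solver-poly approximates)
        solution-poly = proj₁ (proj₂ (solver-poly approximates))
        approximate = proj₂ (proj₂ (solver-poly approximates))

      cut : ∀ x → Cut (network x) (suc zero) zero
      cut x = proj₁ (approximate (inst x))

      cutBits : List Bool → List Bool
      cutBits x = Vec.toList (inside ∷ proj₁ (star-cut (cut x)))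

      solution-cut : ∀ x → tail (solution (inst x)) ≡ encodeBits (cutBits x)
      solution-cut x = cong tail (trans (proj₁ (proj₂ (approximate (inst x))))
                                        (cong encodeSubset (proj₁ (proj₂ (star-cut (cut x))))))

      decide-poly : PolyTime length (decide p) encodeBits (λ x → out (x , decode (cutBits x)))
      decide-poly =
        build-poly ⨾-poly
        frame-poly encodeBits (reindex inst (PolySize.size≼ instance-size) solution-poly) ⨾-poly
        assign-poly _ (λ x → cong (cons (encodeBits x)) (solution-cut x)) ⨾-poly
        check-poly′ id cutBits ≼-refl
          (≼-mono (λ x → ≤-reflexive (length-toList (inside ∷ proj₁ (star-cut (cut x))))) links#≼)

      -- Acceptance always exhibits a witness, since the verifier is rerun on the decoded bits. The
      -- approximation ratio enters only in the converse direction.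
      decides : ∀ {L : Language} {R : List Bool × List Bool → Set} → (∀ a → out a ≢ nil ⇔ R a) →
                (∀ x → L x ⇔ (∃[ y ] length y ≤ bound c k (length x) × R (x , y))) →
                DecidableInPolyTime encodeBits L
      decides {L} {R} verifies witnessed = decide p , poly-solver length≤size-bits decide-poly λ x →
        mk⇔ (λ accepted → from (witnessed x)
               (decode (cutBits x) , length-decode (proj₁ (star-cut (cut x))) , to (verifies _) accepted))
            (λ Lx → let y , |y|≤ , Rxy = to (witnessed x) Lx
                        _ , _ , opt , isMin , cost≤ = approximate (inst x) in
               approximate-accepted x |y|≤ (from (verifies (x , y)) Rxy) (cut x) opt isMin cost≤)
        where open Equivalence

-- The two inclusions between P and NP

P⊆NP : ∀ {L} → InP L → InNP L
P⊆NP {L} (p , decides) = let out , p-poly , correct = solver-poly decides in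
  L ∘ proj₁ ,
  (assign (hd var) ⨾ p , poly-solver
    (λ (x , y) → m≤n⇒m≤1+n (m≤m+n (size (encodeBits x)) (size (encodeBits y))))
    (assign-poly _ (λ _ → refl) ⨾-poly reindex proj₁ ≼-refl p-poly)
    (correct ∘ proj₁)) ,
  -- `bound 0 0` is constantly 0, so the empty list serves as the witness.
  0 , 0 , λ x → mk⇔ (λ Lx → [] , z≤n , Lx) (λ (_ , _ , Lx) → Lx)

NP⊆P : ∀ {α p} → 1ℚ < α → ApproximatesMCDCM α p → ∀ {L} → InNP L → InP L
NP⊆P {α} 1<α approximates (R , (V , verifies) , c , k , witnessed) =
  let out , V-poly , correct = solver-poly verifies
      open Reduction α 1<α c k V-poly
      c′ , k′ , ρ-computed = ρ-computable
      open Construction c′ k′ ρ-computed in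
  decides approximates correct witnessed

theorem5 : ¬ P≡NP → (α : ℚ) → 1ℚ < α → ¬ (∃[ p ] ApproximatesMCDCM α p)
theorem5 P≢NP α 1<α (p , approximates) = P≢NP λ L → mk⇔ P⊆NP (NP⊆P 1<α approximates)
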